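{- Let $P_n$ be the path on $n$ vertices. For all integers $k\geq 3$ and $n\geq 2k-1$, the inequality $p_k(P_n)\geq \left\lfloor \frac{3k}{2}\right\rfloor-2$ holds.
   Context: All graphs are finite simple graphs. $d_G(v,w)$ denotes the distance in $G$ between vertices $v$ and $w$. For a positive integer $p$, the $p$-th power $G^p$ of a graph $G$ is the simple graph with the same vertex set as $G$ in which two distinct vertices $v,w$ are adjacent if and only if $d_G(v,w)\leq p$. A graph $G$ is $k$-ordered Hamiltonian if for any sequence $v_1,v_2,\dots,v_k$ of $k$ distinct vertices of $G$ there is a Hamiltonian cycle in $G$ containing these vertices in the given order, i.e. traversing the cycle from $v_1$ in one of its two directions, one meets $v_1,v_2,\dots,v_k$ in this order before returning to $v_1$. For $k\geq 3$ and a graph $G$, $p_k(G)$ denotes the smallest integer $p$ such that $G^p$ is $k$-ordered Hamiltonian. -}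

module Defs where

open import Data.Fin.Base using (Fin; toℕ) renaming (_<_ to _<ᶠ_)
open import Data.Fin.Permutation using (Permutation′; _⟨$⟩ʳ_; _⟨$⟩ˡ_)
open import Data.Nat.Base using (ℕ; zero; suc; _≤_)
open import Data.Nat.Properties using (1+n≢n)
open import Data.Product.Base using (_×_; _,_; ∃-syntax)
open import Data.Sum.Base using (_⊎_; inj₁; inj₂; swap)
open import Function.Definitions using (Injective)
open import Relation.Binary.Definitions using (Symmetric; Irreflexive)
open import Relation.Binary.PropositionalEquality.Core
  using (_≡_; _≢_; refl; ≢-sym)

IsLeast : (ℕ → Set) → ℕ → Set
IsLeast P m = P m × (∀ j → P j → m ≤ j)

record Graph (n : ℕ) : Set₁ where
  field
    Adj    : Fin n → Fin n → Set
    symm   : Symmetric Adj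
    irrefl : Irreflexive _≡_ Adj

open Graph public using (Adj)

data Walk {n} (G : Graph n) : ℕ → Fin n → Fin n → Set where
  nil  : ∀ {v} → Walk G zero v v
  cons : ∀ {l u v w} → Adj G u v → Walk G l v w → Walk G (suc l) u w

snoc : ∀ {n} {G : Graph n} {l u v w} →
       Walk G l u v → Adj G v w → Walk G (suc l) u w
snoc nil        e = cons e nil
snoc (cons f p) e = cons f (snoc p e)

reverse : ∀ {n} {G : Graph n} {l v w} → Walk G l v w → Walk G l w v
reverse         nil        = nil
reverse {G = G} (cons e p) = snoc (reverse p) (Graph.symm G e)

-- The distance as a functional relation: vertices in different components
-- have no (finite) distance.
IsDistance : ∀ {n} → Graph n → Fin n → Fin n → ℕ → Set
IsDistance G v w = IsLeast (λ l → Walk G l v w)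

IsDistance-sym : ∀ {n} {G : Graph n} {v w d} →
                 IsDistance G v w d → IsDistance G w v d
IsDistance-sym (p , least) = reverse p , λ j q → least j (reverse q)

infixl 8 _^ᵍ_

_^ᵍ_ : ∀ {n} → Graph n → ℕ → Graph n
G ^ᵍ p = record
  { Adj    = λ v w → v ≢ w × ∃[ d ] (IsDistance G v w d × d ≤ p)
  ; symm   = λ { (v≢w , d , dist , d≤p) →
                 ≢-sym v≢w , d , IsDistance-sym {G = G} dist , d≤p }
  ; irrefl = λ { v≡w (v≢w , _) → v≢w v≡w }
  }

CyclicSucc : ∀ {n} → Fin n → Fin n → Set
CyclicSucc {n} i j =
  (toℕ j ≡ suc (toℕ i)) ⊎ (suc (toℕ i) ≡ n × toℕ j ≡ 0)

-- A Hamiltonian cycle together with a starting vertex and a direction of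
-- traversal: the vertices are met in the order  tour ⟨$⟩ʳ 0, tour ⟨$⟩ʳ 1, …
record HamiltonianCycle {n} (G : Graph n) : Set where
  field
    long : 3 ≤ n
    tour : Permutation′ n
    edge : ∀ i j → CyclicSucc i j → Adj G (tour ⟨$⟩ʳ i) (tour ⟨$⟩ʳ j)

  position : Fin n → Fin n
  position v = tour ⟨$⟩ˡ v

-- The traversal starts at the first vertex of the sequence and meets the
-- remaining ones in the given order before closing up.
MeetsInOrder : ∀ {n k} {G : Graph n} →
               HamiltonianCycle G → (Fin k → Fin n) → Set
MeetsInOrder C v =
  (∀ i → toℕ i ≡ 0 → toℕ (position (v i)) ≡ 0) ×
  (∀ i j → i <ᶠ j → position (v i) <ᶠ position (v j))
  where open HamiltonianCycle C

-- Both choices of direction (and of the starting point) are covered by the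
-- quantification over C, since every traversal of a cycle is itself a
-- HamiltonianCycle.
OrderedHamiltonian : ∀ {n} → ℕ → Graph n → Set
OrderedHamiltonian {n} k G =
  ∀ (v : Fin k → Fin n) → Injective _≡_ _≡_ v →
  ∃[ C ] MeetsInOrder {G = G} C v

-- IsOrdHamPower k G p  says that p = p_k(G); only positive exponents count.
IsOrdHamPower : ∀ {n} → ℕ → Graph n → ℕ → Set
IsOrdHamPower k G =
  IsLeast (λ p → 1 ≤ p × OrderedHamiltonian k (G ^ᵍ p))

path : ∀ n → Graph n
path n = record
  { Adj    = λ i j → (suc (toℕ i) ≡ toℕ j) ⊎ (suc (toℕ j) ≡ toℕ i)
  ; symm   = swap
  ; irrefl = λ { refl (inj₁ e) → 1+n≢n e ; refl (inj₂ e) → 1+n≢n e }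
  }

{-# OPTIONS --safe #-}

-- Write D = ⌊3k/2⌋ − 2 and number the vertices of the path from 0.  The k
-- vertices D, 0, D+1, 1, D+2, 2, … all lie below 2k − 2, and consecutive ones
-- are at distance D or D+1, hence not adjacent in the p-th power for p < D.
-- A Hamiltonian cycle meeting them in this order therefore has inner vertices
-- between any two consecutive ones, and the inner vertex next to the lower end
-- lies below the upper end, hence below 2k − 2.  This gives k + (k − 1)
-- distinct vertices below 2k − 2.
--
-- That p_k exists: the n-th power is complete, so every sequence of distinct
-- vertices extends to a Hamiltonian cycle, and being k-ordered Hamiltonian is
-- decidable because there are finitely many sequences and tours.
module Submission where

open import Data.Fin.Base
  using (Fin; zero; suc; toℕ; fromℕ<; inject₁; inject≤; punchIn; punchOut; join; splitAt;
         finToFun; funToFin)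
  renaming (_<_ to _<ᶠ_)
open import Data.Fin.Permutation
  using (Permutation′; permutation; _⟨$⟩ʳ_; _⟨$⟩ˡ_; inverseˡ; inverseʳ; insert; insert-punchIn)
  renaming (id to idₚ)
open import Data.Fin.Properties
  using (_≟_; any?; all?; toℕ<n; toℕ-injective; toℕ-fromℕ<; toℕ-inject₁; toℕ-inject≤;
         punchOut-injective; punchIn-punchOut; finToFun-funToFin; injective⇒≤; join-splitAt;
         suc-injective)
  renaming (_<?_ to _<ᶠ?_)
open import Data.Nat.Base
open import Data.Nat.DivMod using (_/_; _%_; m≡m%n+[m/n]*n; m%n<n; m/n*n≤m; /-monoˡ-≤)
open import Data.Nat.Induction using (<-wellFounded)
open import Data.Nat.Properties hiding (_≟_; suc-injective)
import Data.Nat.Properties as ℕ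
open import Data.Nat.Tactic.RingSolver using (solve-∀)
open import Data.Product.Base using (_×_; _,_; ∃-syntax; proj₁; proj₂)
open import Data.Sum.Base using (_⊎_; inj₁; inj₂)
open import Function.Base using (_∘_)
open import Function.Definitions using (Injective)
open import Induction.WellFounded using (Acc; acc)
open import Relation.Binary.Definitions using (tri<; tri≈; tri>)
open import Relation.Binary.PropositionalEquality
  using (_≡_; _≢_; _≗_; refl; sym; trans; cong; subst; subst₂)
open import Relation.Nullary
  using (Dec; yes; no; contradiction; map′; _×-dec_; _⊎-dec_; _→-dec_; ¬?)
open import Relation.Unary using (Decidable)
open import Defs

-- Least elements and decidability

-- Well-founded descent from the given witness: a bounded search finds a smaller witness or
-- certifies that the current one is least.
decidable⇒least : ∀ {P : ℕ → Set} → Decidable P → ∀ m → P m → ∃[ l ] IsLeast P l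
decidable⇒least {P} P? m Pm = go m Pm (<-wellFounded m)
  where
  go : ∀ m → P m → Acc _<_ m → ∃[ l ] IsLeast P l
  go m Pm (acc rec) with anyUpTo? P? m
  ... | yes (l , l<m , Pl) = go l Pl (rec l<m)
  ... | no  none           = m , Pm , λ j Pj → ≮⇒≥ λ j<m → none (j , j<m , Pj)

injective? : ∀ {k n} (v : Fin k → Fin n) → Dec (Injective _≡_ _≡_ v)
injective? v = map′ (λ h {i} {j} → h i j) (λ h i j → h {i} {j})
  (all? λ i → all? λ j → (v i ≟ v j) →-dec (i ≟ j))

cyclicSucc? : ∀ {n} (i j : Fin n) → Dec (CyclicSucc i j)
cyclicSucc? {n} i j =
  (toℕ j ℕ.≟ suc (toℕ i)) ⊎-dec ((suc (toℕ i) ℕ.≟ n) ×-dec (toℕ j ℕ.≟ 0))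

module _ {n k : ℕ} (G : Graph n) where

  -- A Hamiltonian cycle meeting v in order, with its tour f and the inverse g
  -- as bare functions, so that the candidates can be enumerated.
  Traversal : (Fin k → Fin n) → (f g : Fin n → Fin n) → Set
  Traversal v f g =
    3 ≤ n × (∀ i → f (g i) ≡ i) × (∀ i → g (f i) ≡ i) ×
    (∀ i j → CyclicSucc i j → Adj G (f i) (f j)) ×
    (∀ i → toℕ i ≡ 0 → toℕ (g (v i)) ≡ 0) ×
    (∀ i j → i <ᶠ j → g (v i) <ᶠ g (v j))

  -- Decoding a coded function returns it only up to pointwise equality, so traversals have to be
  -- transported along `≗`.
  Traversal-resp : ∀ {v v′ f f′ g g′} → v ≗ v′ → f ≗ f′ → g ≗ g′ →
                   Traversal v f g → Traversal v′ f′ g′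
  Traversal-resp {v} {v′} {f} {f′} {g} {g′} v≗ f≗ g≗ (long , fg , gf , edge , start , order) =
      long
    , (λ i → trans (sym (trans (cong f (g≗ i)) (f≗ (g′ i)))) (fg i))
    , (λ i → trans (sym (trans (cong g (f≗ i)) (g≗ (f′ i)))) (gf i))
    , (λ i j s → subst₂ (Adj G) (f≗ i) (f≗ j) (edge i j s))
    , (λ i i≡0 → trans (cong toℕ (sym (gv i))) (start i i≡0))
    , (λ i j i<j → subst₂ _<ᶠ_ (gv i) (gv j) (order i j i<j))
    where
    gv : ∀ i → g (v i) ≡ g′ (v′ i)
    gv i = trans (cong g (v≗ i)) (g≗ (v′ i))

  toTraversal : ∀ {v} → ∃[ C ] MeetsInOrder {G = G} C v → ∃[ f ] ∃[ g ] Traversal v f g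
  toTraversal (C , start , order) =
    (tour ⟨$⟩ʳ_) , (tour ⟨$⟩ˡ_) , long ,
    (λ _ → inverseʳ tour) , (λ _ → inverseˡ tour) , edge , start , order
    where open HamiltonianCycle C

  fromTraversal : ∀ {v} → ∃[ f ] ∃[ g ] Traversal v f g → ∃[ C ] MeetsInOrder {G = G} C v
  fromTraversal (f , g , long , fg , gf , edge , start , order) =
    record { long = long ; tour = permutation f g fg gf ; edge = edge } , start , order

  module _ (adj? : ∀ u w → Dec (Adj G u w)) where

    traversal? : ∀ v f g → Dec (Traversal v f g)
    traversal? v f g =
      (3 ≤? n) ×-dec
      (all? λ i → f (g i) ≟ i) ×-dec
      (all? λ i → g (f i) ≟ i) ×-dec
      (all? λ i → all? λ j → cyclicSucc? i j →-dec adj? (f i) (f j)) ×-dec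
      (all? λ i → (toℕ i ℕ.≟ 0) →-dec (toℕ (g (v i)) ℕ.≟ 0)) ×-dec
      (all? λ i → all? λ j → (i <ᶠ? j) →-dec (g (v i) <ᶠ? g (v j)))

    meetsInOrder? : ∀ v → Dec (∃[ C ] MeetsInOrder {G = G} C v)
    meetsInOrder? v = map′
      (λ (a , b , t) → fromTraversal (finToFun a , finToFun b , t))
      (λ m → let f , g , t = toTraversal m in
        funToFin f , funToFin g ,
        Traversal-resp (λ _ → refl) (sym ∘ finToFun-funToFin f) (sym ∘ finToFun-funToFin g) t)
      (any? λ a → any? λ b → traversal? v (finToFun a) (finToFun b))

    -- Each sequence agrees pointwise with a decoded element of a finite type, so checking all codes
    -- suffices.
    orderedHamiltonian? : Dec (OrderedHamiltonian k G)
    orderedHamiltonian? = map′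
      (λ h v v-inj →
        let v≗ = finToFun-funToFin v
            f , g , t = toTraversal (h (funToFin v) λ {i} {j} e →
              v-inj (trans (sym (v≗ i)) (trans e (v≗ j))))
        in fromTraversal (f , g , Traversal-resp v≗ (λ _ → refl) (λ _ → refl) t))
      (λ h c → h (finToFun c))
      (all? λ c → injective? (finToFun c) →-dec meetsInOrder? (finToFun c))

-- Powers of paths

ascending-walk : ∀ {n} l (u w : Fin n) → toℕ w ≡ l + toℕ u → Walk (path n) l u w
ascending-walk     zero    u w eq rewrite toℕ-injective eq = nil
ascending-walk {n} (suc l) u w eq =
  cons (inj₁ (sym u⁺≡)) (ascending-walk l u⁺ w (trans eq
    (trans (sym (+-suc l (toℕ u))) (cong (l +_) (sym u⁺≡)))))
  where
  u⁺<n : suc (toℕ u) < n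
  u⁺<n = ≤-<-trans (subst (suc (toℕ u) ≤_) (sym eq) (s≤s (m≤n+m (toℕ u) l))) (toℕ<n w)

  u⁺ : Fin n
  u⁺ = fromℕ< u⁺<n

  u⁺≡ : toℕ u⁺ ≡ suc (toℕ u)
  u⁺≡ = toℕ-fromℕ< u⁺<n

walk⇒∣-∣≤ : ∀ {n l} {u w : Fin n} → Walk (path n) l u w → ∣ toℕ u - toℕ w ∣ ≤ l
walk⇒∣-∣≤ {u = u} nil = ≤-reflexive (∣n-n∣≡0 (toℕ u))
walk⇒∣-∣≤ {u = u} {w} (cons {v = v} e walk) = ≤-trans
  (∣-∣-triangle (toℕ u) (toℕ v) (toℕ w)) (+-mono-≤ (step e) (walk⇒∣-∣≤ walk))
  where
  ∣m-1+m∣≤1 : ∀ m → ∣ m - suc m ∣ ≤ 1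
  ∣m-1+m∣≤1 zero    = ≤-refl
  ∣m-1+m∣≤1 (suc m) = ∣m-1+m∣≤1 m

  step : Adj (path _) u v → ∣ toℕ u - toℕ v ∣ ≤ 1
  step (inj₁ e) rewrite sym e = ∣m-1+m∣≤1 (toℕ u)
  step (inj₂ e) rewrite sym e | ∣-∣-comm (suc (toℕ v)) (toℕ v) = ∣m-1+m∣≤1 (toℕ v)

path-distance : ∀ {n} (u w : Fin n) → IsDistance (path n) u w ∣ toℕ u - toℕ w ∣
path-distance {n} u w = walk , λ _ → walk⇒∣-∣≤
  where
  walk : Walk (path n) ∣ toℕ u - toℕ w ∣ u w
  walk with ≤-total (toℕ u) (toℕ w)
  ... | inj₁ u≤w rewrite m≤n⇒∣m-n∣≡n∸m u≤w = ascending-walk _ u w (sym (m∸n+n≡m u≤w))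
  ... | inj₂ w≤u rewrite m≤n⇒∣n-m∣≡n∸m w≤u =
    reverse (ascending-walk _ w u (sym (m∸n+n≡m w≤u)))

module _ {n p : ℕ} {u w : Fin n} where

  adj⇒∣-∣≤ : Adj (path n ^ᵍ p) u w → ∣ toℕ u - toℕ w ∣ ≤ p
  adj⇒∣-∣≤ (_ , _ , (walk , _) , d≤p) = ≤-trans (walk⇒∣-∣≤ walk) d≤p

  ∣-∣≤⇒adj : u ≢ w → ∣ toℕ u - toℕ w ∣ ≤ p → Adj (path n ^ᵍ p) u w
  ∣-∣≤⇒adj u≢w d≤p = u≢w , _ , path-distance u w , d≤p

pathPower-adj? : ∀ {n} p (u w : Fin n) → Dec (Adj (path n ^ᵍ p) u w)
pathPower-adj? p u w = map′
  (λ (u≢w , d≤p) → ∣-∣≤⇒adj u≢w d≤p)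
  (λ adj → proj₁ adj , adj⇒∣-∣≤ adj)
  (¬? (u ≟ w) ×-dec (∣ toℕ u - toℕ w ∣ ≤? p))

-- Complete graphs

-- Induction on `k`: fix the image of `zero`, delete it from the codomain with `punchOut`, and
-- extend what remains of `v`.
extend-injection : ∀ {k n} (k≤n : k ≤ n) (v : Fin k → Fin n) → Injective _≡_ _≡_ v →
                   ∃[ π ] (∀ i → π ⟨$⟩ʳ inject≤ i k≤n ≡ v i)
extend-injection {zero}          _         v v-inj = idₚ , λ ()
extend-injection {suc k} {suc n} (s≤s k≤n) v v-inj = insert zero (v zero) π , spec
  where
  v₀≢ : ∀ i → v zero ≢ v (suc i)
  v₀≢ i eq with () ← v-inj eq

  rest : ∃[ π ] (∀ i → π ⟨$⟩ʳ inject≤ i k≤n ≡ punchOut (v₀≢ i))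
  rest = extend-injection k≤n (λ i → punchOut (v₀≢ i)) λ {i} {j} eq →
    suc-injective (v-inj (punchOut-injective (v₀≢ i) (v₀≢ j) eq))

  π : Permutation′ n
  π = proj₁ rest

  spec : ∀ i → insert zero (v zero) π ⟨$⟩ʳ inject≤ i (s≤s k≤n) ≡ v i
  spec zero    = refl
  spec (suc i) = trans (insert-punchIn zero (v zero) π (inject≤ i k≤n))
    (trans (cong (punchIn (v zero)) (proj₂ rest i)) (punchIn-punchOut (v₀≢ i)))

-- The wrap-around from the last index to 0 could be a loop only for `n` equal to 1.
cyclicSucc⇒≢ : ∀ {n} {i j : Fin n} → 2 ≤ n → CyclicSucc i j → i ≢ j
cyclicSucc⇒≢ 2≤n (inj₁ eq)         refl = 1+n≢n (sym eq)
cyclicSucc⇒≢ 2≤n (inj₂ (eq , i≡0)) refl =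
  <⇒≢ 2≤n (trans (cong suc (sym i≡0)) eq)

complete⇒orderedHamiltonian : ∀ {k n} {G : Graph n} → 3 ≤ n → k ≤ n →
                              (∀ u w → u ≢ w → Adj G u w) → OrderedHamiltonian k G
complete⇒orderedHamiltonian {k} {n} {G} 3≤n k≤n complete v v-inj = C , start , order
  where
  extension = extend-injection k≤n v v-inj

  π : Permutation′ n
  π = proj₁ extension

  C : HamiltonianCycle G
  C = record
    { long = 3≤n
    ; tour = π
    ; edge = λ i j s → complete _ _ λ eq → cyclicSucc⇒≢ (≤-trans (n≤1+n 2) 3≤n) s
        (trans (sym (inverseˡ π)) (trans (cong (π ⟨$⟩ˡ_) eq) (inverseˡ π)))
    }

  position-v : ∀ i → toℕ (π ⟨$⟩ˡ v i) ≡ toℕ i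
  position-v i = trans
    (cong toℕ (trans (cong (π ⟨$⟩ˡ_) (sym (proj₂ extension i))) (inverseˡ π)))
    (toℕ-inject≤ i k≤n)

  start : ∀ i → toℕ i ≡ 0 → toℕ (π ⟨$⟩ˡ v i) ≡ 0
  start i i≡0 = trans (position-v i) i≡0

  order : ∀ i j → i <ᶠ j → (π ⟨$⟩ˡ v i) <ᶠ (π ⟨$⟩ˡ v j)
  order i j i<j = subst₂ _<_ (sym (position-v i)) (sym (position-v j)) i<j

pathPower-orderedHamiltonian : ∀ {k n} → 3 ≤ n → k ≤ n → OrderedHamiltonian k (path n ^ᵍ n)
pathPower-orderedHamiltonian 3≤n k≤n = complete⇒orderedHamiltonian 3≤n k≤n λ u w u≢w →
  ∣-∣≤⇒adj u≢w (≤-trans (∣m-n∣≤m⊔n (toℕ u) (toℕ w)) (⊔-lub (<⇒≤ (toℕ<n u)) (<⇒≤ (toℕ<n w))))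

-- Obstruction to meeting vertices in order

-- A point nearer to the lower end `m` than `n` is may lie on either side of `m`, but cannot reach
-- up to `n`.
∣m-o∣<∣m-n∣⇒o<n : ∀ {m n o} → m ≤ n → ∣ m - o ∣ < ∣ m - n ∣ → o < n
∣m-o∣<∣m-n∣⇒o<n {m} {n} {o} m≤n lt = begin-strict
  o              ≤⟨ m≤n+∣n-m∣ o m ⟩
  m + ∣ m - o ∣  <⟨ +-monoʳ-< m lt ⟩
  m + ∣ m - n ∣  ≡⟨ cong (m +_) (m≤n⇒∣m-n∣≡n∸m m≤n) ⟩
  m + (n ∸ m)    ≡⟨ m+[n∸m]≡n m≤n ⟩
  n              ∎
  where open ≤-Reasoning

module _ {n p : ℕ} (C : HamiltonianCycle (path n ^ᵍ p)) where
  open HamiltonianCycle C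

  vertexAt-position : ∀ a → tour ⟨$⟩ʳ position a ≡ a
  vertexAt-position a = inverseʳ tour

  step-∣-∣≤ : ∀ {i j} → toℕ j ≡ suc (toℕ i) → ∣ toℕ (tour ⟨$⟩ʳ i) - toℕ (tour ⟨$⟩ʳ j) ∣ ≤ p
  step-∣-∣≤ {i} {j} eq = adj⇒∣-∣≤ (edge i j (inj₁ eq))

  inner-vertex : ∀ {a b N} → toℕ a < N → toℕ b < N → position a <ᶠ position b →
                 p < ∣ toℕ a - toℕ b ∣ →
                 ∃[ r ] (position a <ᶠ r × r <ᶠ position b × toℕ (tour ⟨$⟩ʳ r) < N)
  inner-vertex {a} {b} {N} a<N b<N qa<qb far with ≤-total (toℕ a) (toℕ b)
  ... | inj₁ a≤b = r , ≤-reflexive (sym r≡) , subst (_< _) (sym r≡) qa⁺<qb ,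
          <-trans (∣m-o∣<∣m-n∣⇒o<n a≤b (≤-<-trans near far)) b<N
    where
    -- If `b` came directly after `a`, they would be joined by an edge of the cycle, against `far`.
    qa⁺<qb : suc (toℕ (position a)) < toℕ (position b)
    qa⁺<qb = ≤∧≢⇒< qa<qb λ eq → <⇒≱ far
      (subst₂ (λ x y → ∣ toℕ x - toℕ y ∣ ≤ p) (vertexAt-position a) (vertexAt-position b)
        (step-∣-∣≤ (sym eq)))

    r<n : suc (toℕ (position a)) < n
    r<n = <-trans qa⁺<qb (toℕ<n (position b))

    r : Fin n
    r = fromℕ< r<n

    r≡ : toℕ r ≡ suc (toℕ (position a))
    r≡ = toℕ-fromℕ< r<n

    near : ∣ toℕ a - toℕ (tour ⟨$⟩ʳ r) ∣ ≤ p
    near = subst (λ x → ∣ toℕ x - toℕ (tour ⟨$⟩ʳ r) ∣ ≤ p) (vertexAt-position a) (step-∣-∣≤ r≡)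
  -- Now `b` is the lower end, so the inner vertex is taken directly before `b`.
  ... | inj₂ b≤a = r , subst (_ <_) (sym r≡) qa<qb⁻ , ≤-reflexive r⁺≡ ,
          <-trans (∣m-o∣<∣m-n∣⇒o<n b≤a (≤-<-trans near
            (subst (p <_) (∣-∣-comm (toℕ a) (toℕ b)) far))) a<N
    where
    qb⁻ : ℕ
    qb⁻ = pred (toℕ (position b))

    qb≡ : suc qb⁻ ≡ toℕ (position b)
    -- The position of `b` is positive because that of `a` lies below it, so `pred` does not
    -- truncate.
    qb≡ = suc-pred _ {{>-nonZero (≤-<-trans z≤n qa<qb)}}

    qa<qb⁻ : toℕ (position a) < qb⁻
    qa<qb⁻ = ≤∧≢⇒< (s≤s⁻¹ (subst (_ <_) (sym qb≡) qa<qb)) λ eq → <⇒≱ far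
      (subst₂ (λ x y → ∣ toℕ x - toℕ y ∣ ≤ p) (vertexAt-position a) (vertexAt-position b)
        (step-∣-∣≤ (trans (sym qb≡) (cong suc (sym eq)))))

    r<n : qb⁻ < n
    r<n = <-trans (≤-reflexive qb≡) (toℕ<n (position b))

    r : Fin n
    r = fromℕ< r<n

    r≡ : toℕ r ≡ qb⁻
    r≡ = toℕ-fromℕ< r<n

    r⁺≡ : suc (toℕ r) ≡ toℕ (position b)
    r⁺≡ = trans (cong suc r≡) qb≡

    near : ∣ toℕ b - toℕ (tour ⟨$⟩ʳ r) ∣ ≤ p
    near = subst (_≤ p) (∣-∣-comm (toℕ (tour ⟨$⟩ʳ r)) (toℕ b))
      (subst (λ x → ∣ toℕ (tour ⟨$⟩ʳ r) - toℕ x ∣ ≤ p) (vertexAt-position b) (step-∣-∣≤ (sym r⁺≡)))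

  -- The `suc m` positions of the sequence and the `m` inner ones strictly interleave, hence are
  -- distinct. Reading off their vertices embeds `Fin (suc m + m)` into `Fin N`.
  far-sequence⇒≤ : ∀ {m N} (v : Fin (suc m) → Fin n) → MeetsInOrder C v →
                   (∀ i → toℕ (v i) < N) →
                   (∀ (i : Fin m) → p < ∣ toℕ (v (inject₁ i)) - toℕ (v (suc i)) ∣) →
                   suc m + m ≤ N
  far-sequence⇒≤ {m} {N} v (_ , order) v<N far = injective⇒≤ {f = vertex ∘ splitAt (suc m)}
    λ {x} {y} eq → splitAt-injective
      (slot-injective _ _ (vertex-injective (splitAt (suc m) x) (splitAt (suc m) y) eq))
    where
    splitAt-injective : ∀ {x y} → splitAt (suc m) {m} x ≡ splitAt (suc m) y → x ≡ y
    splitAt-injective {x} {y} eq = trans (sym (join-splitAt (suc m) m x))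
      (trans (cong (join (suc m) m) eq) (join-splitAt (suc m) m y))

    q : Fin (suc m) → ℕ
    q i = toℕ (position (v i))

    inner : (i : Fin m) → ∃[ r ] (position (v (inject₁ i)) <ᶠ r ×
                                  r <ᶠ position (v (suc i)) × toℕ (tour ⟨$⟩ʳ r) < N)
    inner i = inner-vertex (v<N _) (v<N _)
      (order (inject₁ i) (suc i) (s≤s (≤-reflexive (toℕ-inject₁ i)))) (far i)

    slot : Fin (suc m) ⊎ Fin m → Fin n
    slot (inj₁ i) = position (v i)
    slot (inj₂ i) = proj₁ (inner i)

    slot-bound : ∀ s → toℕ (tour ⟨$⟩ʳ slot s) < N
    slot-bound (inj₁ i) = subst (λ x → toℕ x < N) (sym (vertexAt-position (v i))) (v<N i)
    slot-bound (inj₂ i) = proj₂ (proj₂ (proj₂ (inner i)))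

    vertex : Fin (suc m) ⊎ Fin m → Fin N
    vertex s = fromℕ< (slot-bound s)

    vertex-injective : ∀ s t → vertex s ≡ vertex t → slot s ≡ slot t
    vertex-injective s t eq = trans (sym (inverseˡ tour)) (trans (cong (tour ⟨$⟩ˡ_)
      (toℕ-injective (trans (sym (toℕ-fromℕ< (slot-bound s)))
        (trans (cong toℕ eq) (toℕ-fromℕ< (slot-bound t)))))) (inverseˡ tour))

    q-mono : ∀ {i j} → toℕ i ≤ toℕ j → q i ≤ q j
    q-mono {i} {j} i≤j with m≤n⇒m<n∨m≡n i≤j
    ... | inj₁ i<j = <⇒≤ (order i j i<j)
    ... | inj₂ i≡j = ≤-reflexive (cong q (toℕ-injective i≡j))

    inner-after : ∀ i j → toℕ i ≤ toℕ j → q i < toℕ (proj₁ (inner j))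
    inner-after i j i≤j = ≤-<-trans
      (q-mono (subst (toℕ i ≤_) (sym (toℕ-inject₁ j)) i≤j)) (proj₁ (proj₂ (inner j)))

    inner-before : ∀ i j → toℕ j < toℕ i → toℕ (proj₁ (inner j)) < q i
    -- `j<i` is by definition `suc (toℕ j) ≤ toℕ i`, the form that `q-mono` needs for the entry
    -- `suc j`.
    inner-before i j j<i = <-≤-trans (proj₁ (proj₂ (proj₂ (inner j)))) (q-mono j<i)

    inner-mono : ∀ i j → toℕ i < toℕ j → toℕ (proj₁ (inner i)) < toℕ (proj₁ (inner j))
    inner-mono i j i<j = <-trans (inner-before (suc i) i ≤-refl) (inner-after (suc i) j i<j)

    q≢inner : ∀ i j → slot (inj₁ i) ≢ slot (inj₂ j)
    q≢inner i j eq with <-≤-connex (toℕ j) (toℕ i)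
    ... | inj₁ j<i = <⇒≢ (inner-before i j j<i) (cong toℕ (sym eq))
    ... | inj₂ i≤j = <⇒≢ (inner-after i j i≤j) (cong toℕ eq)

    slot-injective : ∀ s t → slot s ≡ slot t → s ≡ t
    slot-injective (inj₁ i) (inj₁ j) eq with <-cmp (toℕ i) (toℕ j)
    ... | tri< i<j _ _ = contradiction (cong toℕ eq) (<⇒≢ (order i j i<j))
    ... | tri≈ _ i≡j _ = cong inj₁ (toℕ-injective i≡j)
    ... | tri> _ _ j<i = contradiction (cong toℕ (sym eq)) (<⇒≢ (order j i j<i))
    slot-injective (inj₁ i) (inj₂ j) eq = contradiction eq (q≢inner i j)
    slot-injective (inj₂ i) (inj₁ j) eq = contradiction (sym eq) (q≢inner j i)
    slot-injective (inj₂ i) (inj₂ j) eq with <-cmp (toℕ i) (toℕ j)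
    ... | tri< i<j _ _ = contradiction (cong toℕ eq) (<⇒≢ (inner-mono i j i<j))
    ... | tri≈ _ i≡j _ = cong inj₂ (toℕ-injective i≡j)
    ... | tri> _ _ j<i = contradiction (cong toℕ (sym eq)) (<⇒≢ (inner-mono j i j<i))

-- The zigzag sequence

-- The sequence of the opening comment with `h` for `D`. Recursion by two steps shifts both
-- interleaved progressions by one.
zigzag : ℕ → ℕ → ℕ
zigzag h 0             = h
zigzag h 1             = 0
zigzag h (suc (suc j)) = suc (zigzag h j)

-- The gaps alternate between `h` and `h + 1`, since a common shift preserves differences.
zigzag-gap : ∀ h j → h ≤ ∣ zigzag h j - zigzag h (suc j) ∣
zigzag-gap h 0             = ≤-reflexive (sym (∣-∣-identityʳ h))
zigzag-gap h 1             = n≤1+n h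
zigzag-gap h (suc (suc j)) = zigzag-gap h j

-- Doubling avoids halving the index; even indices attain equality.
zigzag-bound : ∀ h j → 2 * zigzag h j ≤ 2 * h + j
zigzag-bound h 0             = m≤m+n (2 * h) 0
zigzag-bound h 1             = z≤n
zigzag-bound h (suc (suc j)) = begin
  2 * suc (zigzag h j)  ≡⟨ *-suc 2 (zigzag h j) ⟩
  2 + 2 * zigzag h j    ≤⟨ +-monoʳ-≤ 2 (zigzag-bound h j) ⟩
  2 + (2 * h + j)       ≡⟨ double h j ⟩
  2 * h + (2 + j)       ∎
  where
  open ≤-Reasoning
  double : ∀ h j → 2 + (2 * h + j) ≡ 2 * h + (2 + j)
  double = solve-∀

-- Before step 2e the odd-indexed entries are still below e, and the
-- even-indexed ones are at least h, with equality only at the start.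
zigzag-first : ∀ h e j → e ≤ h → j < 2 * e → zigzag h j ≡ e → j ≡ 0 × e ≡ h
zigzag-first h e       0             e≤h j<2e eq = refl , sym eq
zigzag-first h (suc e) 1             e≤h j<2e ()
zigzag-first h (suc e) (suc (suc j)) e<h j<2e eq = contradiction
  (proj₂ (zigzag-first h e j (<⇒≤ e<h)
    (s≤s⁻¹ (s≤s⁻¹ (subst (suc (suc j) <_) (*-suc 2 e) j<2e))) (ℕ.suc-injective eq)))
  (<⇒≢ e<h)

-- Indices of at least 2 are lowered together. Against index 0, `zigzag-first` with `e` equal to `h`
-- applies; index 1 has entry 0, while all later entries are successors.
zigzag-injective : ∀ h i j → i < 2 * h → j < 2 * h → zigzag h i ≡ zigzag h j → i ≡ j
zigzag-injective h 0             j             i< j< eq =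
  sym (proj₁ (zigzag-first h h j ≤-refl j< (sym eq)))
zigzag-injective h i@(suc _)     0             i< j< eq =
  proj₁ (zigzag-first h h i ≤-refl i< eq)
zigzag-injective h 1             1             i< j< eq = refl
zigzag-injective h (suc (suc i)) (suc (suc j)) i< j< eq =
  cong (2 +_) (zigzag-injective h i j (<-trans (n<1+n i) (<-trans (n<1+n _) i<))
    (<-trans (n<1+n j) (<-trans (n<1+n _) j<)) (ℕ.suc-injective eq))

-- The lower bound

module _ (m : ℕ) (2≤m : 2 ≤ m) where

  private
    -- With `k` equal to `suc m`, `h` is the `D` of the opening comment and `m + m` is its `2k − 2`.
    half h : ℕ
    half = (3 * suc m) / 2
    h = half ∸ 2

    -- Subtracting 2 is exact, because `k ≥ 3` makes `half` at least 4.
    2h+4≡half*2 : 2 * h + 4 ≡ half * 2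
    2h+4≡half*2 = trans (distrib h) (cong (_* 2) (m∸n+n≡m {half} {2}
      (≤-trans (m≤m+n 2 2) (/-monoˡ-≤ 2 (*-monoʳ-≤ 3 (s≤s 2≤m))))))
      where
      distrib : ∀ h → 2 * h + 4 ≡ (h + 2) * 2
      distrib = solve-∀

    -- Together with `zigzag-bound` this keeps the entries up to index `m` below `m + m`.
    2h-upper : 2 * h + m < 2 * (m + m)
    2h-upper = +-cancelʳ-≤ 3 _ _ (begin
      suc (2 * h + m) + 3  ≡⟨ shuffle (2 * h) m ⟩
      2 * h + 4 + m        ≡⟨ cong (_+ m) 2h+4≡half*2 ⟩
      half * 2 + m         ≤⟨ +-monoˡ-≤ m (m/n*n≤m (3 * suc m) 2) ⟩
      3 * suc m + m        ≡⟨ collect m ⟩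
      2 * (m + m) + 3      ∎)
      where
      open ≤-Reasoning
      shuffle : ∀ x m → suc (x + m) + 3 ≡ x + 4 + m
      shuffle = solve-∀
      collect : ∀ m → 3 * suc m + m ≡ 2 * (m + m) + 3
      collect = solve-∀

    -- Puts all indices up to `m` in the range where `zigzag` is injective.
    2h-lower : m < 2 * h
    2h-lower = +-cancelʳ-≤ 6 _ _ (begin
      suc m + 6                          ≡⟨ split m ⟩
      2 * 2 + m + 3                      ≤⟨ +-monoˡ-≤ 3 (+-monoˡ-≤ m (*-monoʳ-≤ 2 2≤m)) ⟩
      2 * m + m + 3                      ≡⟨ collect m ⟩
      3 * suc m                          ≡⟨ m≡m%n+[m/n]*n (3 * suc m) 2 ⟩
      -- Bounding the remainder by 2 instead of 1 is enough here.
      (3 * suc m) % 2 + half * 2         ≤⟨ +-monoˡ-≤ (half * 2) (<⇒≤ (m%n<n (3 * suc m) 2)) ⟩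
      2 + half * 2                       ≡⟨ cong (2 +_) (sym 2h+4≡half*2) ⟩
      2 + (2 * h + 4)                    ≡⟨ shuffle (2 * h) ⟩
      2 * h + 6                          ∎)
      where
      open ≤-Reasoning
      split : ∀ m → suc m + 6 ≡ 2 * 2 + m + 3
      split = solve-∀
      collect : ∀ m → 2 * m + m + 3 ≡ 3 * suc m
      collect = solve-∀
      shuffle : ∀ x → 2 + (x + 4) ≡ x + 6
      shuffle = solve-∀

  orderedHamiltonian⇒≤ : ∀ {n p} → m + m ≤ n → OrderedHamiltonian (suc m) (path n ^ᵍ p) →
                         (3 * suc m) / 2 ∸ 2 ≤ p
  orderedHamiltonian⇒≤ {n} {p} 2m≤n ordHam = ≮⇒≥ λ p<h →
    let C , meets = ordHam v v-injective in
    -- The count gives `suc m + m ≤ m + m`, which is `m + m < m + m`.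
    <-irrefl refl (far-sequence⇒≤ C v meets v<2m λ i →
      subst₂ (λ x y → p < ∣ x - y ∣)
        (sym (trans (v≡ (inject₁ i)) (cong (zigzag h) (toℕ-inject₁ i))))
        (sym (v≡ (suc i)))
        (<-≤-trans p<h (zigzag-gap h (toℕ i))))
    where
    zigzag<2m : ∀ (i : Fin (suc m)) → zigzag h (toℕ i) < m + m
    zigzag<2m i = *-cancelˡ-< 2 _ _ (≤-<-trans (zigzag-bound h (toℕ i))
      (≤-<-trans (+-monoʳ-≤ (2 * h) (s≤s⁻¹ (toℕ<n i))) 2h-upper))

    v : Fin (suc m) → Fin n
    v i = fromℕ< (<-≤-trans (zigzag<2m i) 2m≤n)

    v≡ : ∀ i → toℕ (v i) ≡ zigzag h (toℕ i)
    v≡ i = toℕ-fromℕ< (<-≤-trans (zigzag<2m i) 2m≤n)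

    v<2m : ∀ i → toℕ (v i) < m + m
    v<2m i = subst (_< m + m) (sym (v≡ i)) (zigzag<2m i)

    index<2h : ∀ (i : Fin (suc m)) → toℕ i < 2 * h
    index<2h i = ≤-<-trans (s≤s⁻¹ (toℕ<n i)) 2h-lower

    v-injective : Injective _≡_ _≡_ v
    v-injective {i} {j} eq = toℕ-injective (zigzag-injective h _ _ (index<2h i) (index<2h j)
      (trans (sym (v≡ i)) (trans (cong toℕ eq) (v≡ j))))

theorem3p1 : ∀ (k n : ℕ) → 3 ≤ k → 2 * k ∸ 1 ≤ n →
    ∃[ p ] (IsOrdHamPower k (path n) p × (3 * k) / 2 ∸ 2 ≤ p)
theorem3p1 k@(suc m) n 3≤k 2k-1≤n =
  p , isLeast , orderedHamiltonian⇒≤ m (s≤s⁻¹ 3≤k) 2m≤n (proj₂ (proj₁ isLeast))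
  where
  2m≤n : m + m ≤ n
  -- `2 * k ∸ 1` computes to `m + (suc m + 0)`.
  2m≤n = ≤-trans (+-monoʳ-≤ m (≤-trans (n≤1+n m) (m≤m+n (suc m) 0))) 2k-1≤n

  k≤n : k ≤ n
  k≤n = ≤-trans (+-monoˡ-≤ m (≤-trans (n≤1+n 1) (s≤s⁻¹ 3≤k))) 2m≤n

  3≤n : 3 ≤ n
  3≤n = ≤-trans 3≤k k≤n

  least : ∃[ p ] IsOrdHamPower k (path n) p
  least = decidable⇒least
    (λ p → (1 ≤? p) ×-dec orderedHamiltonian? (path n ^ᵍ p) (pathPower-adj? p))
    -- The search starts from the exponent `n`, at which the power is complete.
    n (≤-trans (s≤s z≤n) 3≤n , pathPower-orderedHamiltonian 3≤n k≤n)

  p : ℕ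
  p = proj₁ least

  isLeast : IsOrdHamPower k (path n) p
  isLeast = proj₂ least
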